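{- Assume the setting in the context, with $\delta=0$ (so $y>0$ and $\theta>0$). Set $A_m=\lfloor z_0/\theta\rfloor$. Write $y_0=\overline{y_0}\,y+\widehat{y_0}$ and $h=\overline{h}\,y+\widehat{h}$ with $0\le \widehat{y_0},\widehat{h}<y$; when $w>0$ also write $x_0=\overline{x_0}\,w+\widehat{x_0}$ and $l=\overline{l}\,w+\widehat{l}$ with $0\le\widehat{x_0},\widehat{l}<w$. (i.1) If $w=0$, then $$d(m,T)=(1+A_m)(1+A_m+\overline{y_0})+(\overline{h}-2)\frac{A_m(1+A_m)}{2}+\sum_{k=0}^{A_m}\left\lfloor\frac{\widehat{y_0}+k\widehat{h}}{y}\right\rfloor. \quad (*)$$ (i.2) If $w>0$, set $k_0=\left\lceil\frac{z_0w-x_0\theta}{b}\right\rceil$ (then $k_0\ge 0$). (i.2.1) If $k_0=0$, then $d(m,T)$ is given by $(*)$. (i.2.2) If $1\le k_0\le A_m$, then $$d(m,T)=(1+A_m)(1+A_m+\overline{y_0})+k_0(\overline{x_0}-A_m)+(\overline{h}-2)\frac{A_m(1+A_m)}2+\overline{l}\frac{(k_0-1)k_0}{2}+\sum_{k=0}^{A_m}\left\lfloor\frac{\widehat{y_0}+k\widehat{h}}{y}\right\rfloor+\sum_{k=0}^{k_0-1}\left\lfloor\frac{\widehat{x_0}+k\widehat{l}}{w}\right\rfloor.$$ (i.2.3) If $k_0>A_m$, then $$d(m,T)=(1+A_m)(1+\overline{x_0}+\overline{y_0})+(\overline{l}+\overline{h}-2)\frac{A_m(1+A_m)}2+\sum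_{k=0}^{A_m}\left\lfloor\frac{\widehat{x_0}+k\widehat{l}}{w}\right\rfloor+\sum_{k=0}^{A_m}\left\lfloor\frac{\widehat{y_0}+k\widehat{h}}{y}\right\rfloor.$$
   Context: Let $a<b<c$ be positive integers with $\gcd(a,b,c)=1$ and $T=\langle a,b,c\rangle=\{xa+yb+zc:x,y,z\in\mathbb N\}$. For $m\in T$, the denumerant $d(m,T)$ is the number of $(x,y,z)\in\mathbb N^3$ with $xa+yb+zc=m$. For $(i,j)\in\mathbb N^2$ let $[\![i,j]\!]=[i,i+1)\times[j,j+1)\subset\mathbb R^2$. For integers $0\le w<l$, $0\le y<h$, the L-shape $\mathrm L(l,h,w,y)$ is the set of unit squares $[\![i,j]\!]$ with $0\le i<l$, $0\le j<h$, excluding those with $i\ge l-w$ and $j\ge h-y$ (it has $lh-wy$ squares). An L-shape $\mathcal H$ is related to $T$ if it consists of exactly $c$ squares, every residue class modulo $c$ equals $ia+jb \bmod c$ for exactly one $[\![i,j]\!]\in\mathcal H$, and for each $[\![i,j]\!]\in\mathcal H$, $ia+jb=\min\{sa+tb:(s,t)\in\mathbb N^2,\ sa+tb\equiv ia+jb \pmod c\}$. Setting: $\mathcal H=\mathrm L(l,h,w,y)$ is an L-shape related to $T$, and $\delta=(la-yb)/c$, $\theta=(hb-wa)/c$; it is known that $\delta,\theta$ are nonnegative integers with $\delta+\theta>0$, $a=h\delta+y\theta$, $b=w\delta+l\theta$, $lh-wy=c$. For $m\in T$, the basic factorization of $m$ with respect to $\mathcal H$ is the unique $(x_0,y_0,z_0)\in\mathbb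 N^3$ with $x_0a+y_0b+z_0c=m$ and $[\![x_0,y_0]\!]\in\mathcal H$. Fix $m\in T$ with basic factorization $(x_0,y_0,z_0)$. -}

module Defs where

open import Data.List using (List; length; filter; cartesianProduct; upTo; applyUpTo; sum)
open import Data.List.Membership.Propositional using (_∈_)
open import Data.List.Membership.Propositional.Properties
  using (∈-filter⁺; ∈-filter⁻; ∈-cartesianProduct⁺; ∈-upTo⁺)
open import Data.List.Relation.Unary.Unique.Propositional using (Unique)
import Data.List.Relation.Unary.Unique.Propositional.Properties as Uniqueₚ
open import Data.Nat using (ℕ; suc; _+_; _*_; _∸_; _%_; _≤_; _<_; s≤s; NonZero)
open import Data.Nat.Properties
  using (_≟_; ≤-trans; m≤m*n; m≤m+n; m≤n+m)
open import Data.Product using (_×_; _,_; ∃; ∃!; proj₂)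
open import Function.Bundles using (_⇔_; mk⇔)
open import Relation.Binary.PropositionalEquality using (_≡_; refl)
open import Relation.Nullary using (¬_)
open import Relation.Unary using (Decidable)

infix 4 _∈⟨_,_,_⟩ ⟦_,_⟧∈_

∑< : ℕ → (ℕ → ℕ) → ℕ
∑< n f = sum (applyUpTo f n)

-- The summation index ranges over 0, …, n − 1.
syntax ∑< n (λ k → e) = ∑[ k < n ] e

IsFactorization : (a b c m : ℕ) → ℕ × ℕ × ℕ → Set
IsFactorization a b c m (x , y , z) = x * a + y * b + z * c ≡ m

_∈⟨_,_,_⟩ : ℕ → ℕ → ℕ → ℕ → Set
m ∈⟨ a , b , c ⟩ = ∃ (IsFactorization a b c m)

isFactorization? : ∀ a b c m → Decidable (IsFactorization a b c m)
isFactorization? a b c m (x , y , z) = x * a + y * b + z * c ≟ m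

box : ℕ → List (ℕ × ℕ × ℕ)
box m = cartesianProduct (upTo (suc m)) (cartesianProduct (upTo (suc m)) (upTo (suc m)))

-- Searching 0, …, m in each coordinate loses nothing when a, b, c are
-- positive: see ∈-factorizations and factorizations-unique.
factorizations : (a b c m : ℕ) → List (ℕ × ℕ × ℕ)
factorizations a b c m =
  filter (isFactorization? a b c m) (box m)

denumerant : (a b c m : ℕ) → ℕ
denumerant a b c m = length (factorizations a b c m)

∈-factorizations : ∀ a b c m .{{_ : NonZero a}} .{{_ : NonZero b}} .{{_ : NonZero c}} p →
                   p ∈ factorizations a b c m ⇔ IsFactorization a b c m p
∈-factorizations a b c m (x , y , z) = mk⇔
  (λ p∈ → proj₂ (∈-filter⁻ (isFactorization? a b c m) {xs = box m} p∈))
  (λ { refl → ∈-filter⁺ (isFactorization? a b c m)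
         (∈-cartesianProduct⁺ (∈-upTo⁺ (s≤s x≤))
           (∈-cartesianProduct⁺ (∈-upTo⁺ (s≤s y≤)) (∈-upTo⁺ (s≤s z≤)))) refl })
  where
  x≤ : x ≤ x * a + y * b + z * c
  x≤ = ≤-trans (m≤m*n x a) (≤-trans (m≤m+n (x * a) (y * b)) (m≤m+n _ (z * c)))
  y≤ : y ≤ x * a + y * b + z * c
  y≤ = ≤-trans (m≤m*n y b) (≤-trans (m≤n+m (y * b) (x * a)) (m≤m+n _ (z * c)))
  z≤ : z ≤ x * a + y * b + z * c
  z≤ = ≤-trans (m≤m*n z c) (m≤n+m (z * c) (x * a + y * b))

factorizations-unique : ∀ a b c m → Unique (factorizations a b c m)
factorizations-unique a b c m =
  Uniqueₚ.filter⁺ (isFactorization? a b c m)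
    (Uniqueₚ.cartesianProduct⁺ (Uniqueₚ.upTo⁺ (suc m))
      (Uniqueₚ.cartesianProduct⁺ (Uniqueₚ.upTo⁺ (suc m)) (Uniqueₚ.upTo⁺ (suc m))))

record LShape : Set where
  field
    l h w y : ℕ
    w<l     : w < l
    y<h     : y < h

-- The unit square [i , i+1) × [j , j+1) is represented by its corner (i , j).
⟦_,_⟧∈_ : ℕ → ℕ → LShape → Set
⟦ i , j ⟧∈ H = i < l × j < h × ¬ (l ∸ w ≤ i × h ∸ y ≤ j)
  where open LShape H

-- Number of unit squares: the l × h box minus its w × y corner.
area : LShape → ℕ
area H = l * h ∸ w * y
  where open LShape H

record Related (a b c : ℕ) .{{_ : NonZero c}} (H : LShape) : Set where
  field
    area≡c  : area H ≡ c
    residue : ∀ r → r < c →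
              ∃! _≡_ λ ((i , j) : ℕ × ℕ) → ⟦ i , j ⟧∈ H × (i * a + j * b) % c ≡ r
    minimal : ∀ i j → ⟦ i , j ⟧∈ H → ∀ s t →
              (s * a + t * b) % c ≡ (i * a + j * b) % c →
              i * a + j * b ≤ s * a + t * b

IsBasicFactorization : (a b c : ℕ) (H : LShape) (m : ℕ) → ℕ × ℕ × ℕ → Set
IsBasicFactorization a b c H m (x₀ , y₀ , z₀) =
  IsFactorization a b c m (x₀ , y₀ , z₀) × ⟦ x₀ , y₀ ⟧∈ H

{-# OPTIONS --safe #-}

-- With δ = 0 the setting forces a = y θ and b = l θ, and the lattice of integer
-- relations s a + t b + u c = 0 has basis (−w , h , −θ), (l , −y , 0).  Hence the
-- factorizations of m are (x₀ , y₀ , z₀) + k (−w , h , −θ) + j (l , −y , 0), where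
-- minimality of the squares of H and x₀ < l force k , j ≥ 0.  Nonnegativity of the
-- last two entries means k ≤ A and j ≤ ⌊(y₀ + k h) / y⌋, which gives (*).  From this
-- one subtracts the pairs with x₀ + j l < k w; counted column by column there are
-- A − ⌊(x₀ + j l) / w⌋ of them for each j < k₀ and none for j ≥ k₀.  Finally w < l
-- yields k₀ ≤ 1 + A, so that k₀ > A is the single case k₀ = 1 + A.
module Submission where

open import Defs
open import Data.Nat
  using (ℕ; zero; suc; _+_; _*_; _∸_; _/_; _%_; _≤_; _<_; _≤?_; NonZero; z≤n; s≤s; z<s; s<s;
         s≤s⁻¹; s<s⁻¹; >-nonZero; >-nonZero⁻¹)
open import Data.Nat.Coprimality using (Coprime; coprime-divisor)
open import Data.Nat.DivMod
open import Data.Nat.Divisibility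
open import Data.Nat.GCD using (gcd; gcd-greatest)
open import Data.Nat.Properties
open import Data.Nat.Tactic.RingSolver using (solve-∀)
open import Data.Integer as ℤ using (ℤ; +_; -[1+_])
import Data.Integer.DivMod as ℤ
import Data.Integer.Properties as ℤ
import Data.Integer.Tactic.RingSolver as ℤ-RingSolver
import Data.Rational.Unnormalised as ℚᵘ
open import Data.Empty using (⊥)
open import Data.List using (List; map; _++_; length; upTo)
open import Data.List.Properties using (length-map; length-++; length-upTo)
open import Data.List.Membership.Propositional using (_∈_)
open import Data.List.Membership.Propositional.Properties
  using (∈-map⁺; ∈-map⁻; ∈-++⁺ˡ; ∈-++⁺ʳ; ∈-++⁻; ∈-upTo⁺; ∈-upTo⁻)
open import Data.List.Membership.Propositional.Properties.WithK using (unique∧set⇒bag)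
open import Data.List.Relation.Binary.BagAndSetEquality using (∼bag⇒↭)
open import Data.List.Relation.Binary.Permutation.Propositional.Properties using (↭-length)
import Data.List.Relation.Unary.All as All
import Data.List.Relation.Unary.All.Properties as Allₚ
open import Data.List.Relation.Unary.AllPairs using ([]; _∷_)
open import Data.List.Relation.Unary.Any using (here; there)
open import Data.List.Relation.Unary.Unique.Propositional using (Unique)
import Data.List.Relation.Unary.Unique.Propositional.Properties as Uniqueₚ
open import Data.Product using (_×_; _,_; ∃; Σ-syntax; proj₁; proj₂; map₁)
open import Data.Sum using (inj₁; inj₂)
open import Function using (_∘_; id; it; _⇔_; mk⇔; Equivalence)
open import Relation.Binary.PropositionalEquality
open import Relation.Nullary using (yes; no)
open import Relation.Nullary.Negation using (contradiction)

-- Finite sums, and sums of floors along an arithmetic progression.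

∑-cong : ∀ n {f g : ℕ → ℕ} → (∀ k → k < n → f k ≡ g k) → ∑< n f ≡ ∑< n g
∑-cong zero    eq = refl
∑-cong (suc n) eq = cong₂ _+_ (eq 0 z<s) (∑-cong n λ k k<n → eq (suc k) (s<s k<n))

∑-+ : ∀ n (f g : ℕ → ℕ) → ∑[ k < n ] (f k + g k) ≡ ∑< n f + ∑< n g
∑-+ zero    f g = refl
∑-+ (suc n) f g = trans (cong (λ u → f 0 + g 0 + u) (∑-+ n (f ∘ suc) (g ∘ suc)))
                        (interchange (f 0) (g 0) _ _)
  where
  interchange : ∀ p q r s → p + q + (r + s) ≡ p + r + (q + s)
  interchange = solve-∀

∑-const : ∀ n t → ∑[ _ < n ] t ≡ n * t
∑-const zero    t = refl
∑-const (suc n) t = cong (λ u → t + u) (∑-const n t)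

∑-*ʳ : ∀ n (f : ℕ → ℕ) t → ∑[ k < n ] (f k * t) ≡ ∑< n f * t
∑-*ʳ zero    f t = refl
∑-*ʳ (suc n) f t = trans (cong (λ u → f 0 * t + u) (∑-*ʳ n (f ∘ suc) t))
                         (sym (*-distribʳ-+ t (f 0) _))

-- Doubling keeps the induction free of division; the quotient by 2 is recovered afterwards, where
-- it is exact.
∑-id-doubled : ∀ n → ∑< n id * 2 ≡ (n ∸ 1) * n
∑-id-doubled zero    = refl
∑-id-doubled (suc n) = begin
  ∑< n suc * 2                 ≡⟨ cong (_* 2) (∑-+ n (λ _ → 1) id) ⟩
  (∑[ _ < n ] 1 + ∑< n id) * 2 ≡⟨ *-distribʳ-+ 2 (∑[ _ < n ] 1) _ ⟩
  ∑[ _ < n ] 1 * 2 + ∑< n id * 2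
    ≡⟨ cong₂ (λ s t → s * 2 + t) (∑-const n 1) (∑-id-doubled n) ⟩
  n * 1 * 2 + (n ∸ 1) * n      ≡⟨ step n ⟩
  n * suc n                    ∎
  where
  open ≡-Reasoning
  step : ∀ n → n * 1 * 2 + (n ∸ 1) * n ≡ n * suc n
  -- The case split removes the truncated `n ∸ 1`, which the ring solver cannot treat.
  step zero    = refl
  step (suc n) = poly n
    where
    poly : ∀ n → suc n * 1 * 2 + n * suc n ≡ suc n * suc (suc n)
    poly = solve-∀

∑-id : ∀ n → ∑< n id ≡ (n ∸ 1) * n / 2
∑-id n = trans (sym (m*n/n≡m (∑< n id) 2)) (/-congˡ (∑-id-doubled n))

-- Dividing p and q by d with remainder, the multiples of d leave the floor. This is where the
-- barred and hatted quantities of the statement come from.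
[p+kq]/d-split : ∀ p q d k .{{_ : NonZero d}} →
                 (p + k * q) / d ≡ p / d + k * (q / d) + (p % d + k * (q % d)) / d
[p+kq]/d-split p q d k = begin
  (p + k * q) / d
    ≡⟨ /-congˡ (cong₂ (λ s t → s + k * t) (m≡m%n+[m/n]*n p d) (m≡m%n+[m/n]*n q d)) ⟩
  (p % d + p / d * d + k * (q % d + q / d * d)) / d
    ≡⟨ /-congˡ (regroup (p % d) (p / d) d k (q % d) (q / d)) ⟩
  ((p / d + k * (q / d)) * d + (p % d + k * (q % d))) / d
    ≡⟨ +-distrib-/-∣ˡ _ (n∣m*n (p / d + k * (q / d))) ⟩
  (p / d + k * (q / d)) * d / d + (p % d + k * (q % d)) / d
    ≡⟨ cong (_+ (p % d + k * (q % d)) / d) (m*n/n≡m (p / d + k * (q / d)) d) ⟩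
  p / d + k * (q / d) + (p % d + k * (q % d)) / d ∎
  where
  open ≡-Reasoning
  regroup : ∀ r s d k r′ s′ →
            r + s * d + k * (r′ + s′ * d) ≡ (s + k * s′) * d + (r + k * r′)
  regroup = solve-∀

-- Used with (p , q , d) = (y₀ , h , y) for the full count and with (x₀ , l , w) for the excess.
∑-[p+kq]/d : ∀ n p q d .{{_ : NonZero d}} →
             ∑[ k < n ] ((p + k * q) / d) ≡
             n * (p / d) + (n ∸ 1) * n / 2 * (q / d) + ∑[ k < n ] ((p % d + k * (q % d)) / d)
∑-[p+kq]/d n p q d = begin
  ∑[ k < n ] ((p + k * q) / d)
    ≡⟨ ∑-cong n (λ k _ → [p+kq]/d-split p q d k) ⟩
  ∑[ k < n ] (p / d + k * (q / d) + (p % d + k * (q % d)) / d)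
    ≡⟨ ∑-+ n (λ k → p / d + k * (q / d)) _ ⟩
  ∑[ k < n ] (p / d + k * (q / d)) + rest
    ≡⟨ cong (_+ rest) (∑-+ n (λ _ → p / d) (λ k → k * (q / d))) ⟩
  ∑[ _ < n ] (p / d) + ∑[ k < n ] (k * (q / d)) + rest
    ≡⟨ cong (_+ rest) (cong₂ _+_ (∑-const n (p / d))
         (trans (∑-*ʳ n id (q / d)) (cong (_* (q / d)) (∑-id n)))) ⟩
  n * (p / d) + (n ∸ 1) * n / 2 * (q / d) + rest ∎
  where
  open ≡-Reasoning
  rest = ∑[ k < n ] ((p % d + k * (q % d)) / d)

-- Lattice points under a graph, and counting with duplicate-free lists.

column₀ : ℕ → ℕ × ℕ
column₀ = 0 ,_

shift : ℕ × ℕ → ℕ × ℕ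
shift = map₁ suc

-- The bound on the second coordinate is strict, so a region j ≤ g k is encoded by the function 1 +
-- g.
subgraph : ℕ → (ℕ → ℕ) → List (ℕ × ℕ)
subgraph zero    f = List.[]
subgraph (suc n) f = map column₀ (upTo (f 0)) ++ map shift (subgraph n (f ∘ suc))

length-subgraph : ∀ n f → length (subgraph n f) ≡ ∑< n f
length-subgraph zero    f = refl
length-subgraph (suc n) f =
  trans (length-++ (map column₀ (upTo (f 0))))
    (cong₂ _+_ (trans (length-map column₀ (upTo (f 0))) (length-upTo (f 0)))
               (trans (length-map shift (subgraph n (f ∘ suc))) (length-subgraph n (f ∘ suc))))

∈-subgraph⁺ : ∀ n f {k j} → k < n → j < f k → (k , j) ∈ subgraph n f
∈-subgraph⁺ (suc n) f {zero}  _     j<f0 = ∈-++⁺ˡ (∈-map⁺ column₀ (∈-upTo⁺ j<f0))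
∈-subgraph⁺ (suc n) f {suc k} 1+k<n j<fk =
  ∈-++⁺ʳ (map column₀ (upTo (f 0))) (∈-map⁺ shift (∈-subgraph⁺ n (f ∘ suc) (s<s⁻¹ 1+k<n) j<fk))

∈-subgraph⁻ : ∀ n f {k j} → (k , j) ∈ subgraph n f → k < n × j < f k
∈-subgraph⁻ (suc n) f p∈ with ∈-++⁻ (map column₀ (upTo (f 0))) p∈
... | inj₁ q∈ with _ , j∈ , refl ← ∈-map⁻ column₀ q∈ = z<s , ∈-upTo⁻ j∈
... | inj₂ q∈ with _ , r∈ , refl ← ∈-map⁻ shift q∈ =
  map₁ s<s (∈-subgraph⁻ n (f ∘ suc) r∈)

subgraph-unique : ∀ n f → Unique (subgraph n f)
subgraph-unique zero    f = []
subgraph-unique (suc n) f = Uniqueₚ.++⁺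
  (Uniqueₚ.map⁺ (cong proj₂) (Uniqueₚ.upTo⁺ (f 0)))
  (Uniqueₚ.map⁺ (λ { refl → refl }) (subgraph-unique n (f ∘ suc)))
  λ { (q∈ , r∈) → disjoint (∈-map⁻ column₀ q∈) (∈-map⁻ shift r∈) }
  where
  disjoint : ∀ {p} → (∃ λ j → j ∈ upTo (f 0) × p ≡ (0 , j)) →
             (∃ λ r → r ∈ subgraph n (f ∘ suc) × p ≡ shift r) → ⊥
  disjoint (_ , _ , refl) (_ , _ , ())

-- Injectivity is asked only on members of the list: the coordinate map below ignores the middle
-- entry of a triple and is injective only among factorizations.
map-unique : ∀ {A B : Set} (f : A → B) {xs} →
             (∀ {x y} → x ∈ xs → y ∈ xs → f x ≡ f y → x ≡ y) →
             Unique xs → Unique (map f xs)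
map-unique f inj []         = []
map-unique f inj (x∉ ∷ xs!) =
  Allₚ.map⁺ (All.tabulate λ y∈ fx≡fy → All.lookup x∉ y∈ (inj (here refl) (there y∈) fx≡fy))
  ∷ map-unique f (λ x∈ y∈ → inj (there x∈) (there y∈)) xs!

-- Without duplicates, equality as sets is equality as bags, hence a permutation.
length-≡ : ∀ {A : Set} {xs ys : List A} → Unique xs → Unique ys →
           (∀ {x} → x ∈ xs ⇔ x ∈ ys) → length xs ≡ length ys
length-≡ xs! ys! xs∼ys = ↭-length (∼bag⇒↭ (unique∧set⇒bag xs! ys! xs∼ys))

-- Ceilings of integer quotients.

-- The ceiling is minus the floor of -n / d, so the amount r by which it overshoots is the remainder
-- of -n.
ceiling-remainder : ∀ n d .{{_ : NonZero d}} →
                    Σ[ r ∈ ℕ ] r < d × ℚᵘ.ceiling (n ℚᵘ./ d) ℤ.* + d ≡ n ℤ.+ + r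
ceiling-remainder n d@(suc _) = r , ℤ.n%ℕd<d (ℤ.- n) d , (begin
  ℤ.- (ℤ.- n ℤ./ + d) ℤ.* + d
    ≡⟨ cong (λ t → ℤ.- t ℤ.* + d) (ℤ.div-pos-is-/ℕ (ℤ.- n) d) ⟩
  ℤ.- q ℤ.* + d
    ≡⟨ rearrange (+ r) q (+ d) ⟩
  ℤ.- (+ r ℤ.+ q ℤ.* + d) ℤ.+ + r
    ≡⟨ cong (λ t → ℤ.- t ℤ.+ + r) (ℤ.a≡a%ℕn+[a/ℕn]*n (ℤ.- n) d) ⟨
  ℤ.- (ℤ.- n) ℤ.+ + r
    ≡⟨ cong (ℤ._+ + r) (ℤ.neg-involutive n) ⟩
  n ℤ.+ + r ∎)
  where
  open ≡-Reasoning
  r = (ℤ.- n) ℤ.%ℕ d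
  q = (ℤ.- n) ℤ./ℕ d
  rearrange : ∀ r q d → ℤ.- q ℤ.* d ≡ ℤ.- (r ℤ.+ q ℤ.* d) ℤ.+ r
  rearrange = ℤ-RingSolver.solve-∀

-- Since q < d, the quotient (p - q) / d exceeds -1, so its ceiling is a natural number.
ceiling-ℕ : ∀ p q d .{{_ : NonZero d}} → q < d →
            Σ[ k ∈ ℕ ] + k ≡ ℚᵘ.ceiling ((+ p ℤ.- + q) ℚᵘ./ d) ×
            (Σ[ r ∈ ℕ ] r < d × k * d + q ≡ p + r)
ceiling-ℕ p q d q<d with ℚᵘ.ceiling ((+ p ℤ.- + q) ℚᵘ./ d) | ceiling-remainder (+ p ℤ.- + q) d
... | + k | r , r<d , eq = k , refl , r , r<d , ℤ.+-injective (begin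
  + (k * d + q)                ≡⟨ cong (ℤ._+ + q) (ℤ.pos-* k d) ⟩
  + k ℤ.* + d ℤ.+ + q          ≡⟨ cong (ℤ._+ + q) eq ⟩
  + p ℤ.- + q ℤ.+ + r ℤ.+ + q  ≡⟨ rearrange (+ p) (+ q) (+ r) ⟩
  + p ℤ.+ + r                  ∎)
  where
  open ≡-Reasoning
  rearrange : ∀ p q r → p ℤ.- q ℤ.+ r ℤ.+ q ≡ p ℤ.+ r
  rearrange = ℤ-RingSolver.solve-∀
-- A ceiling of -(1 + k) would give q = p + r + (1 + k) d, which is at least d.
... | -[1+ k ] | r , r<d , eq =
  contradiction (≤-trans (m≤m+n d (k * d)) (≤-trans (m≤n+m (suc k * d) (p + r)) (≤-reflexive q≡)))
                (<⇒≱ q<d)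
  where
  open ≡-Reasoning
  rearrange : ∀ p q r t d → p ℤ.- q ℤ.+ r ℤ.- ℤ.- t ℤ.* d ℤ.+ q ≡ p ℤ.+ r ℤ.+ t ℤ.* d
  rearrange = ℤ-RingSolver.solve-∀
  cancel : ∀ s q → s ℤ.- s ℤ.+ q ≡ q
  cancel = ℤ-RingSolver.solve-∀
  q≡ : p + r + suc k * d ≡ q
  q≡ = ℤ.+-injective (begin
    + p ℤ.+ + r ℤ.+ + (suc k * d)
      ≡⟨ cong (λ t → + p ℤ.+ + r ℤ.+ t) (ℤ.pos-* (suc k) d) ⟩
    + p ℤ.+ + r ℤ.+ + suc k ℤ.* + d
      ≡⟨ rearrange (+ p) (+ q) (+ r) (+ suc k) (+ d) ⟨
    + p ℤ.- + q ℤ.+ + r ℤ.- -[1+ k ] ℤ.* + d ℤ.+ + q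
      ≡⟨ cong (λ t → t ℤ.- -[1+ k ] ℤ.* + d ℤ.+ + q) eq ⟨
    -[1+ k ] ℤ.* + d ℤ.- -[1+ k ] ℤ.* + d ℤ.+ + q
      ≡⟨ cancel (-[1+ k ] ℤ.* + d) (+ q) ⟩
    + q ∎)

-- Exact subtraction, floor inequalities and triangular numbers.

-- Turns the integer differences defining δ and θ into relations over ℕ.
minuend-≡ : ∀ s t u → + s ≡ + t ℤ.- + u → s + u ≡ t
minuend-≡ s t u eq = ℤ.+-injective (trans (cong (ℤ._+ + u) eq) (cancel (+ t) (+ u)))
  where
  cancel : ∀ t u → t ℤ.- u ℤ.+ u ≡ t
  cancel = ℤ-RingSolver.solve-∀

∑-∸ : ∀ n N f → (∀ k → k < n → f k ≤ N) → ∑[ k < n ] (N ∸ f k) + ∑< n f ≡ n * N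
∑-∸ n N f f≤N = begin
  ∑[ k < n ] (N ∸ f k) + ∑< n f  ≡⟨ ∑-+ n (λ k → N ∸ f k) f ⟨
  ∑[ k < n ] (N ∸ f k + f k)     ≡⟨ ∑-cong n (λ k k<n → m∸n+n≡m (f≤N k k<n)) ⟩
  ∑[ _ < n ] N                   ≡⟨ ∑-const n N ⟩
  n * N                          ∎
  where open ≡-Reasoning

m<[1+m/n]*n : ∀ m n .{{_ : NonZero n}} → m < suc (m / n) * n
m<[1+m/n]*n m n = subst (_< suc (m / n) * n) (sym (m≡m%n+[m/n]*n m n))
                        (+-monoˡ-< (m / n * n) (m%n<n m n))

m*n≤o⇒m≤o/n : ∀ {m n o} .{{_ : NonZero n}} → m * n ≤ o → m ≤ o / n
m*n≤o⇒m≤o/n {m} {n} mn≤o = subst (_≤ _) (m*n/n≡m m n) (/-monoˡ-≤ n mn≤o)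

m≤o/n⇒m*n≤o : ∀ {m n o} .{{_ : NonZero n}} → m ≤ o / n → m * n ≤ o
m≤o/n⇒m*n≤o {_} {n} {o} m≤o/n = ≤-trans (*-monoˡ-≤ n m≤o/n) (m/n*n≤m o n)

triangular-doubled : ∀ A → A * (1 + A) / 2 * 2 ≡ A * (1 + A)
triangular-doubled A = trans (cong (_* 2) (sym (∑-id (1 + A)))) (∑-id-doubled (1 + A))

-- Adding this vanishing term to the plain count turns 1 + A into (1 + A)² and h̄ into
-- h̄ − 2, as in the stated formulas.
triangular-cancel : ∀ A s → s ℤ.+ (+ A ℤ.* + (1 + A) ℤ.- + (A * (1 + A) / 2) ℤ.* + 2) ≡ s
triangular-cancel A s = begin
  s ℤ.+ (+ A ℤ.* + (1 + A) ℤ.- + T ℤ.* + 2)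
    ≡⟨ cong₂ (λ t u → s ℤ.+ (t ℤ.- u)) (ℤ.pos-* A (1 + A)) (ℤ.pos-* T 2) ⟨
  s ℤ.+ (+ (A * (1 + A)) ℤ.- + (T * 2))
    ≡⟨ cong (λ t → s ℤ.+ (+ (A * (1 + A)) ℤ.- + t)) (triangular-doubled A) ⟩
  s ℤ.+ (+ (A * (1 + A)) ℤ.- + (A * (1 + A)))
    ≡⟨ cancel s (+ (A * (1 + A))) ⟩
  s ∎
  where
  open ≡-Reasoning
  T = A * (1 + A) / 2
  cancel : ∀ s t → s ℤ.+ (t ℤ.- t) ≡ s
  cancel = ℤ-RingSolver.solve-∀

-- Comparing two solutions of a linear equation with coprime coefficients.

-- If x < x₀ the difference x₀ ∸ x < l would be a multiple of l.
proportional-shift : ∀ {l y x Y x₀ Y₀} .{{_ : NonZero l}} → Coprime l y → x₀ < l →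
                     x * y + Y * l ≡ x₀ * y + Y₀ * l →
                     ∃ λ j → x ≡ x₀ + j * l × Y + j * y ≡ Y₀
proportional-shift {l} {y} {x} {Y} {x₀} {Y₀} l⊥y x₀<l eq with x₀ ≤? x
... | yes x₀≤x with coprime-divisor l⊥y l∣y*t
  where
  t = x ∸ x₀
  balance : Y * l + y * t ≡ Y₀ * l
  balance = +-cancelˡ-≡ (x₀ * y) _ _ (begin
    x₀ * y + (Y * l + y * t) ≡⟨ regroup x₀ y t (Y * l) ⟩
    (x₀ + t) * y + Y * l     ≡⟨ cong (λ u → u * y + Y * l) (m+[n∸m]≡n x₀≤x) ⟩
    x * y + Y * l            ≡⟨ eq ⟩
    x₀ * y + Y₀ * l          ∎)
    where
    open ≡-Reasoning
    regroup : ∀ x₀ y t s → x₀ * y + (s + y * t) ≡ (x₀ + t) * y + s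
    regroup = solve-∀
  l∣y*t : l ∣ y * t
  l∣y*t = ∣m+n∣m⇒∣n (subst (l ∣_) (sym balance) (n∣m*n Y₀)) (n∣m*n Y)
... | divides j t≡j*l = j , x≡ , *-cancelʳ-≡ _ _ l (+-cancelˡ-≡ (x₀ * y) _ _ (begin
    x₀ * y + (Y + j * y) * l  ≡⟨ regroup x₀ y j l Y ⟩
    (x₀ + j * l) * y + Y * l  ≡⟨ cong (λ u → u * y + Y * l) x≡ ⟨
    x * y + Y * l             ≡⟨ eq ⟩
    x₀ * y + Y₀ * l           ∎))
  where
  open ≡-Reasoning
  x≡ : x ≡ x₀ + j * l
  x≡ = trans (sym (m+[n∸m]≡n x₀≤x)) (cong (λ t → x₀ + t) t≡j*l)
  regroup : ∀ x₀ y j l Y → x₀ * y + (Y + j * y) * l ≡ (x₀ + j * l) * y + Y * l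
  regroup = solve-∀
proportional-shift {l} {y} {x} {Y} {x₀} {Y₀} l⊥y x₀<l eq | no x₀≰x =
  contradiction (∣⇒≤ {{>-nonZero (m<n⇒0<n∸m x<x₀)}} (coprime-divisor l⊥y l∣y*t))
                (<⇒≱ (≤-<-trans (m∸n≤m x₀ x) x₀<l))
  where
  x<x₀ = ≰⇒> x₀≰x
  t = x₀ ∸ x
  balance : Y₀ * l + y * t ≡ Y * l
  balance = +-cancelˡ-≡ (x * y) _ _ (begin
    x * y + (Y₀ * l + y * t) ≡⟨ regroup x y t (Y₀ * l) ⟩
    (x + t) * y + Y₀ * l     ≡⟨ cong (λ u → u * y + Y₀ * l) (m+[n∸m]≡n (<⇒≤ x<x₀)) ⟩
    x₀ * y + Y₀ * l          ≡⟨ eq ⟨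
    x * y + Y * l            ∎)
    where
    open ≡-Reasoning
    regroup : ∀ x₀ y t s → x₀ * y + (s + y * t) ≡ (x₀ + t) * y + s
    regroup = solve-∀
  l∣y*t : l ∣ y * t
  l∣y*t = ∣m+n∣m⇒∣n (subst (l ∣_) (sym balance) (n∣m*n Y)) (n∣m*n Y₀)

-- Factorizations as lattice points, with a = y θ and b = l θ substituted.

module FactorizationLattice
  {c l h w y θ m x₀ y₀ z₀ : ℕ}
  .{{_ : NonZero c}} .{{_ : NonZero l}} .{{_ : NonZero y}} .{{_ : NonZero θ}}
  (w≤l : w ≤ l) (y≤h : y ≤ h) (c+wy≡lh : c + w * y ≡ l * h)
  (l⊥y : Coprime l y) (θ⊥c : Coprime θ c)
  (m₀ : IsFactorization (y * θ) (l * θ) c m (x₀ , y₀ , z₀)) (x₀<l : x₀ < l)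
  -- Minimality of the squares enters in this form; it makes every k nonnegative.
  (z≤z₀ : ∀ x Y z → IsFactorization (y * θ) (l * θ) c m (x , Y , z) → z ≤ z₀)
  where

  private
    instance
      yθ≢0 : NonZero (y * θ)
      yθ≢0 = m*n≢0 y θ
      lθ≢0 : NonZero (l * θ)
      lθ≢0 = m*n≢0 l θ
    A = z₀ / θ
    fy : ℕ → ℕ
    fy k = (y₀ + k * h) / y
    IsFact : ℕ × ℕ × ℕ → Set
    IsFact = IsFactorization (y * θ) (l * θ) c m
    facts : List (ℕ × ℕ × ℕ)
    facts = factorizations (y * θ) (l * θ) c m

  -- The lattice of relations s a + t b + u c = 0 has basis (−w , h , −θ) and
  -- (l , −y , 0); (k , j) are the coordinates of (x , Y , z) − (x₀ , y₀ , z₀).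
  record Coordinates (p : ℕ × ℕ × ℕ) (q : ℕ × ℕ) : Set where
    constructor mkCoordinates
    field
      x-eq : proj₁ p + proj₁ q * w ≡ x₀ + proj₂ q * l
      y-eq : proj₁ (proj₂ p) + proj₂ q * y ≡ y₀ + proj₁ q * h
      z-eq : proj₂ (proj₂ p) + proj₁ q * θ ≡ z₀

  open Coordinates

  -- Adding `extra` to both sides avoids subtraction: its k part matches through c + w y = l h, and
  -- its j part arises on both sides.
  coordinates⇒factorization : ∀ {p q} → Coordinates p q → IsFact p
  coordinates⇒factorization {x , Y , z} {k , j} (mkCoordinates ex eY ez) =
    trans (+-cancelʳ-≡ extra _ _ (begin
      x * (y * θ) + Y * (l * θ) + z * c + extra
        ≡⟨ collect x Y z k j c l w y θ ⟩
      (x + k * w) * (y * θ) + (Y + j * y) * (l * θ) + (z + k * θ) * c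
        ≡⟨ cong₂ _+_ (cong₂ (λ s t → s * (y * θ) + t * (l * θ)) ex eY) (cong (_* c) ez) ⟩
      (x₀ + j * l) * (y * θ) + (y₀ + k * h) * (l * θ) + z₀ * c
        ≡⟨ expand x₀ y₀ z₀ k j c l h y θ ⟩
      x₀ * (y * θ) + y₀ * (l * θ) + z₀ * c + (k * θ * (l * h) + j * y * (l * θ))
        ≡⟨ cong (λ u → x₀ * (y * θ) + y₀ * (l * θ) + z₀ * c + (k * θ * u + j * y * (l * θ)))
                c+wy≡lh ⟨
      x₀ * (y * θ) + y₀ * (l * θ) + z₀ * c + extra ∎)) m₀
    where
    open ≡-Reasoning
    extra = k * θ * (c + w * y) + j * y * (l * θ)
    collect : ∀ x Y z k j c l w y θ →
      x * (y * θ) + Y * (l * θ) + z * c + (k * θ * (c + w * y) + j * y * (l * θ)) ≡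
      (x + k * w) * (y * θ) + (Y + j * y) * (l * θ) + (z + k * θ) * c
    collect = solve-∀
    expand : ∀ x₀ y₀ z₀ k j c l h y θ →
      (x₀ + j * l) * (y * θ) + (y₀ + k * h) * (l * θ) + z₀ * c ≡
      x₀ * (y * θ) + y₀ * (l * θ) + z₀ * c + (k * θ * (l * h) + j * y * (l * θ))
    expand = solve-∀

  -- As θ divides a and b, it divides c (z₀ - z); being coprime to c it divides z₀ - z, which yields
  -- k. Cancelling θ leaves an equation in two unknowns, which yields j.
  factorization⇒coordinates : ∀ {p} → IsFact p → ∃ (Coordinates p)
  factorization⇒coordinates {x , Y , z} mp with coprime-divisor θ⊥c θ∣c*u
    where
    u = z₀ ∸ z
    balance : θ * (x₀ * y + y₀ * l) + c * u ≡ θ * (x * y + Y * l)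
    balance = +-cancelʳ-≡ (z * c) _ _ (begin
      θ * (x₀ * y + y₀ * l) + c * u + z * c         ≡⟨ collect x₀ y₀ z u c l y θ ⟩
      x₀ * (y * θ) + y₀ * (l * θ) + (z + u) * c
        ≡⟨ cong (λ t → x₀ * (y * θ) + y₀ * (l * θ) + t * c) (m+[n∸m]≡n (z≤z₀ x Y z mp)) ⟩
      x₀ * (y * θ) + y₀ * (l * θ) + z₀ * c          ≡⟨ trans m₀ (sym mp) ⟩
      x * (y * θ) + Y * (l * θ) + z * c             ≡⟨ factor x Y (z * c) l y θ ⟩
      θ * (x * y + Y * l) + z * c                   ∎)
      where
      open ≡-Reasoning
      collect : ∀ x₀ y₀ z u c l y θ → θ * (x₀ * y + y₀ * l) + c * u + z * c ≡
                x₀ * (y * θ) + y₀ * (l * θ) + (z + u) * c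
      collect = solve-∀
      factor : ∀ x Y s l y θ →
               x * (y * θ) + Y * (l * θ) + s ≡ θ * (x * y + Y * l) + s
      factor = solve-∀
    θ∣c*u : θ ∣ c * u
    θ∣c*u = ∣m+n∣m⇒∣n (subst (θ ∣_) (sym balance) (m∣m*n _)) (m∣m*n (x₀ * y + y₀ * l))
  ... | divides k u≡kθ =
    -- The step by k comes first: x + k w and Y are compared with x₀ and y₀ + k h.
    let j , ex , eY = proportional-shift {x = x + k * w} l⊥y x₀<l shifted
    in  (k , j) , mkCoordinates ex eY ez
    where
    open ≡-Reasoning
    ez : z + k * θ ≡ z₀
    ez = trans (cong (λ t → z + t) (sym u≡kθ)) (m+[n∸m]≡n (z≤z₀ x Y z mp))
    collect : ∀ x Y z k c l w y θ →
      ((x + k * w) * y + Y * l) * θ + (z * c + k * θ * c) ≡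
      x * (y * θ) + Y * (l * θ) + z * c + k * θ * (c + w * y)
    collect = solve-∀
    expand : ∀ x₀ y₀ z k c l h y θ →
      x₀ * (y * θ) + y₀ * (l * θ) + (z + k * θ) * c + k * θ * (l * h) ≡
      (x₀ * y + (y₀ + k * h) * l) * θ + (z * c + k * θ * c)
    expand = solve-∀
    shifted : (x + k * w) * y + Y * l ≡ x₀ * y + (y₀ + k * h) * l
    shifted = *-cancelʳ-≡ _ _ θ (+-cancelʳ-≡ (z * c + k * θ * c) _ _ (begin
      ((x + k * w) * y + Y * l) * θ + (z * c + k * θ * c)
        ≡⟨ collect x Y z k c l w y θ ⟩
      x * (y * θ) + Y * (l * θ) + z * c + k * θ * (c + w * y)
        ≡⟨ cong₂ (λ s t → s + k * θ * t) (trans mp (sym m₀)) c+wy≡lh ⟩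
      x₀ * (y * θ) + y₀ * (l * θ) + z₀ * c + k * θ * (l * h)
        ≡⟨ cong (λ t → x₀ * (y * θ) + y₀ * (l * θ) + t * c + k * θ * (l * h)) ez ⟨
      x₀ * (y * θ) + y₀ * (l * θ) + (z + k * θ) * c + k * θ * (l * h)
        ≡⟨ expand x₀ y₀ z k c l h y θ ⟩
      (x₀ * y + (y₀ + k * h) * l) * θ + (z * c + k * θ * c) ∎))

  private
    -- These two maps are meaningful only where `Coordinates` holds; there the truncated
    -- subtractions and the quotients are exact.
    toCoordinates : ℕ × ℕ × ℕ → ℕ × ℕ
    toCoordinates (x , _ , z) = let k = (z₀ ∸ z) / θ in k , (x + k * w ∸ x₀) / l

    fromCoordinates : ℕ × ℕ → ℕ × ℕ × ℕ
    fromCoordinates (k , j) = x₀ + j * l ∸ k * w , y₀ + k * h ∸ j * y , z₀ ∸ k * θ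

  toCoordinates-≡ : ∀ {p q} → Coordinates p q → toCoordinates p ≡ q
  toCoordinates-≡ {x , _ , z} {k , j} (mkCoordinates ex _ ez) =
    cong₂ _,_ k≡ (trans (/-congˡ (cong (λ t → x + t * w ∸ x₀) k≡)) j≡)
    where
    k≡ : (z₀ ∸ z) / θ ≡ k
    k≡ = trans (/-congˡ (trans (cong (_∸ z) (sym ez)) (m+n∸m≡n z (k * θ)))) (m*n/n≡m k θ)
    j≡ : (x + k * w ∸ x₀) / l ≡ j
    j≡ = trans (/-congˡ (trans (cong (_∸ x₀) ex) (m+n∸m≡n x₀ (j * l)))) (m*n/n≡m j l)

  fromCoordinates-≡ : ∀ {p q} → Coordinates p q → fromCoordinates q ≡ p
  fromCoordinates-≡ {x , Y , z} {k , j} (mkCoordinates ex eY ez) =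
    cong₂ _,_ (unshift x (k * w) ex) (cong₂ _,_ (unshift Y (j * y) eY) (unshift z (k * θ) ez))
    where
    unshift : ∀ s t {u} → s + t ≡ u → u ∸ t ≡ s
    unshift s t eq = trans (cong (_∸ t) (sym eq)) (m+n∸n≡m s t)

  coordinates : ∀ {p} → p ∈ facts → Coordinates p (toCoordinates p)
  coordinates {p} p∈ =
    let q , pq = factorization⇒coordinates
                   (Equivalence.to (∈-factorizations (y * θ) (l * θ) c m p) p∈)
    in  subst (Coordinates p) (sym (toCoordinates-≡ pq)) pq

  -- The points (k , j) with k θ ≤ z₀ and j y ≤ y₀ + k h are the coordinates of
  -- factorizations, except those with x₀ + j l < k w, which would have x < 0.
  denumerant+excess : ∀ k₀ (fx : ℕ → ℕ) →
    (∀ k j → k ≤ A → x₀ + j * l < k * w → j < k₀ × fx j < k) →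
    (∀ k j → fx j < k → j < k₀ → x₀ + j * l < k * w) →
    denumerant (y * θ) (l * θ) c m + ∑[ j < k₀ ] (A ∸ fx j) ≡
    ∑[ k < 1 + A ] (1 + (y₀ + k * h) / y)
  denumerant+excess k₀ fx excess⁻ excess⁺ = begin
    length facts + ∑[ j < k₀ ] (A ∸ fx j)
      ≡⟨ cong₂ _+_ (length-map toCoordinates facts)
           (trans (length-map column (subgraph k₀ (λ j → A ∸ fx j)))
                  (length-subgraph k₀ (λ j → A ∸ fx j))) ⟨
    length (map toCoordinates facts) + length excess
      ≡⟨ length-++ (map toCoordinates facts) ⟨
    length (map toCoordinates facts ++ excess)
      ≡⟨ length-≡ (Uniqueₚ.++⁺
           (map-unique toCoordinates toCoordinates-injective
              (factorizations-unique (y * θ) (l * θ) c m))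
           (Uniqueₚ.map⁺ (λ {p} {q} → column-injective {p} {q}) (subgraph-unique k₀ (λ j → A ∸ fx j)))
           λ (q∈ , r∈) → <⇒≱ (proj₂ (excess-bounds r∈)) (facts-bound q∈))
         (subgraph-unique (1 + A) (λ k → 1 + fy k)) (mk⇔ to from) ⟩
    length (subgraph (1 + A) (λ k → 1 + fy k))
      ≡⟨ length-subgraph (1 + A) (λ k → 1 + fy k) ⟩
    ∑[ k < 1 + A ] (1 + fy k) ∎
    where
    open ≡-Reasoning
    -- The excess is enumerated by j, with k running over `fx j` + 1, ..., A; the pair is then
    -- swapped back to the order (k , j).
    column : ℕ × ℕ → ℕ × ℕ
    column (j , i) = suc i + fx j , j

    column-injective : ∀ {p q} → column p ≡ column q → p ≡ q
    column-injective {j , i} {j′ , i′} eq with refl ← cong proj₂ eq =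
      cong (j ,_) (+-cancelʳ-≡ (fx j) i i′ (suc-injective (cong proj₁ eq)))

    excess : List (ℕ × ℕ)
    excess = map column (subgraph k₀ (λ j → A ∸ fx j))

    toCoordinates-injective : ∀ {p q} → p ∈ facts → q ∈ facts →
                              toCoordinates p ≡ toCoordinates q → p ≡ q
    toCoordinates-injective p∈ q∈ eq =
      trans (sym (fromCoordinates-≡ (coordinates p∈)))
            (trans (cong fromCoordinates eq) (fromCoordinates-≡ (coordinates q∈)))

    facts-bound : ∀ {k j} → (k , j) ∈ map toCoordinates facts → k * w ≤ x₀ + j * l
    facts-bound {k} {j} q∈ with (x , _ , _) , p∈ , refl ← ∈-map⁻ toCoordinates q∈ =
      subst (k * w ≤_) (x-eq (coordinates p∈)) (m≤n+m (k * w) x)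

    excess-bounds : ∀ {k j} → (k , j) ∈ excess → k ≤ A × x₀ + j * l < k * w
    excess-bounds r∈ with (j , i) , p∈ , refl ← ∈-map⁻ column r∈ =
      let j<k₀ , i<A∸fxj = ∈-subgraph⁻ k₀ (λ j → A ∸ fx j) p∈
          fxj≤A = <⇒≤ (m∸n≢0⇒n<m {A} {fx j} (m<n⇒n≢0 i<A∸fxj))
      in  m≤o∸n⇒m+n≤o (suc i) fxj≤A i<A∸fxj , excess⁺ _ j (s≤s (m≤n+m (fx j) i)) j<k₀

    to : ∀ {q} → q ∈ map toCoordinates facts ++ excess → q ∈ subgraph (1 + A) (λ k → 1 + fy k)
    to {k , j} q∈ with ∈-++⁻ (map toCoordinates facts) q∈
    ... | inj₁ r∈ with (_ , Y , z) , p∈ , refl ← ∈-map⁻ toCoordinates r∈ =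
      let mkCoordinates _ eY ez = coordinates p∈
      in  ∈-subgraph⁺ (1 + A) (λ k → 1 + fy k)
            (s≤s (m*n≤o⇒m≤o/n (subst (k * θ ≤_) ez (m≤n+m (k * θ) z))))
            (s≤s (m*n≤o⇒m≤o/n (subst (j * y ≤_) eY (m≤n+m (j * y) Y))))
    -- An excess point lies in the region: j l < k w ≤ k l gives j < k, and then j y ≤ k h.
    ... | inj₂ r∈ =
      let k≤A , bound = excess-bounds r∈
          j<k = *-cancelʳ-< l j k
                  (<-≤-trans (≤-<-trans (m≤n+m (j * l) x₀) bound) (*-monoʳ-≤ k w≤l))
      in  ∈-subgraph⁺ (1 + A) (λ k → 1 + fy k) (s≤s k≤A) (s≤s (m*n≤o⇒m≤o/n
            (≤-trans (*-mono-≤ (<⇒≤ j<k) y≤h) (m≤n+m (k * h) y₀))))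

    from : ∀ {q} → q ∈ subgraph (1 + A) (λ k → 1 + fy k) → q ∈ map toCoordinates facts ++ excess
    from {k , j} q∈ with ∈-subgraph⁻ (1 + A) (λ k → 1 + fy k) q∈ | k * w ≤? x₀ + j * l
    ... | k<1+A , j<1+fyk | yes bound =
      ∈-++⁺ˡ (subst (_∈ _) (toCoordinates-≡ pq) (∈-map⁺ toCoordinates
        (Equivalence.from (∈-factorizations (y * θ) (l * θ) c m (fromCoordinates (k , j)))
          (coordinates⇒factorization pq))))
      where
      pq : Coordinates (fromCoordinates (k , j)) (k , j)
      pq = mkCoordinates (m∸n+n≡m bound) (m∸n+n≡m (m≤o/n⇒m*n≤o (s≤s⁻¹ j<1+fyk)))
           (m∸n+n≡m (m≤o/n⇒m*n≤o (s≤s⁻¹ k<1+A)))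
    ... | k<1+A , _ | no ¬bound =
      let j<k₀ , fxj<k = excess⁻ k j (s≤s⁻¹ k<1+A) (≰⇒> ¬bound)
          k≡ : suc (k ∸ suc (fx j)) + fx j ≡ k
          k≡ = trans (sym (+-suc _ (fx j))) (m∸n+n≡m fxj<k)
      in  ∈-++⁺ʳ (map toCoordinates facts)
            (subst (λ t → (t , j) ∈ excess) k≡
              (∈-map⁺ column (∈-subgraph⁺ k₀ (λ j → A ∸ fx j) j<k₀
                (m+n≤o⇒m≤o∸n _ (subst (_≤ A) (sym k≡) (s≤s⁻¹ k<1+A))))))

  -- Closed formulas for the count.

  private
    T ȳ₀ h̄ Sy D : ℕ
    T  = A * (1 + A) / 2
    ȳ₀ = y₀ / y
    h̄  = h / y
    Sy = ∑[ k < 1 + A ] ((y₀ % y + k * (h % y)) / y)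
    D  = denumerant (y * θ) (l * θ) c m

    ∑-1+fy : ∑[ k < 1 + A ] (1 + fy k) ≡ 1 + A + ((1 + A) * ȳ₀ + T * h̄ + Sy)
    ∑-1+fy = trans (∑-+ (1 + A) (λ _ → 1) fy)
      (cong₂ _+_ (trans (∑-const (1 + A) 1) (*-identityʳ (1 + A)))
                 (∑-[p+kq]/d (1 + A) y₀ h y))

    ∑-1+fy-ℤ : + (∑[ k < 1 + A ] (1 + fy k)) ≡
               + (1 + A) ℤ.+ (+ (1 + A) ℤ.* + ȳ₀ ℤ.+ + T ℤ.* + h̄ ℤ.+ + Sy)
    ∑-1+fy-ℤ = trans (cong +_ ∑-1+fy)
      (cong₂ (λ s t → + (1 + A) ℤ.+ (s ℤ.+ t ℤ.+ + Sy)) (ℤ.pos-* (1 + A) ȳ₀) (ℤ.pos-* T h̄))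

  -- No point of the region is lost here; this serves both w = 0 and `k₀` = 0.
  no-excess-formula :
    (∀ k j → k ≤ A → k * w ≤ x₀ + j * l) →
    + D ≡ + ((1 + A) * (1 + A + ȳ₀)) ℤ.+ (+ h̄ ℤ.- + 2) ℤ.* + T ℤ.+ + Sy
  no-excess-formula bound = begin
    + D
      -- The excess sum is empty, so `id` is only a placeholder for `fx`.
      ≡⟨ cong +_ (trans (sym (+-identityʳ D)) (denumerant+excess 0 id
           (λ k j k≤A x<kw → contradiction (bound k j k≤A) (<⇒≱ x<kw)) (λ _ _ _ ()))) ⟩
    + (∑[ k < 1 + A ] (1 + fy k))
      ≡⟨ ∑-1+fy-ℤ ⟩
    + (1 + A) ℤ.+ (+ (1 + A) ℤ.* + ȳ₀ ℤ.+ + T ℤ.* + h̄ ℤ.+ + Sy)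
      ≡⟨ triangular-cancel A _ ⟨
    + (1 + A) ℤ.+ (+ (1 + A) ℤ.* + ȳ₀ ℤ.+ + T ℤ.* + h̄ ℤ.+ + Sy) ℤ.+
      (+ A ℤ.* + (1 + A) ℤ.- + T ℤ.* + 2)
      ≡⟨ regroup (+ A) (+ ȳ₀) (+ T) (+ h̄) (+ Sy) ⟩
    + (1 + A) ℤ.* + (1 + A + ȳ₀) ℤ.+ (+ h̄ ℤ.- + 2) ℤ.* + T ℤ.+ + Sy
      ≡⟨ cong (λ t → t ℤ.+ (+ h̄ ℤ.- + 2) ℤ.* + T ℤ.+ + Sy) (ℤ.pos-* (1 + A) (1 + A + ȳ₀)) ⟨
    + ((1 + A) * (1 + A + ȳ₀)) ℤ.+ (+ h̄ ℤ.- + 2) ℤ.* + T ℤ.+ + Sy ∎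
    where
    open ≡-Reasoning
    regroup : ∀ A ȳ₀ T h̄ Sy →
      + 1 ℤ.+ A ℤ.+ ((+ 1 ℤ.+ A) ℤ.* ȳ₀ ℤ.+ T ℤ.* h̄ ℤ.+ Sy) ℤ.+
        (A ℤ.* (+ 1 ℤ.+ A) ℤ.- T ℤ.* + 2) ≡
      (+ 1 ℤ.+ A) ℤ.* (+ 1 ℤ.+ A ℤ.+ ȳ₀) ℤ.+ (h̄ ℤ.- + 2) ℤ.* T ℤ.+ Sy
    regroup = ℤ-RingSolver.solve-∀

  -- k₀ = ⌈(z₀ w − x₀ θ) / (l θ)⌉, given by a division with remainder r.
  module Positive .{{_ : NonZero w}}
    {k₀ r : ℕ} (r<lθ : r < l * θ) (k₀-eq : k₀ * (l * θ) + x₀ * θ ≡ z₀ * w + r)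
    where

    private
      x̄₀ l̄ : ℕ
      x̄₀ = x₀ / w
      l̄  = l / w
      Sx : ℕ → ℕ
      Sx n = ∑[ k < n ] ((x₀ % w + k * (l % w)) / w)
      fx : ℕ → ℕ
      fx j = (x₀ + j * l) / w

      scale : ∀ x₀ j l θ → (x₀ + j * l) * θ ≡ j * (l * θ) + x₀ * θ
      scale = solve-∀

    -- By the ceiling equation, j < `k₀` amounts to j l θ < z₀ w - x₀ θ. This direction uses r ≥ 0,
    -- the converse below uses r < l θ.
    bound⇒j<k₀ : ∀ {j} → (x₀ + j * l) * θ < z₀ * w → j < k₀
    bound⇒j<k₀ {j} bound = *-cancelʳ-< (l * θ) j k₀ (+-cancelʳ-< (x₀ * θ) _ _ (begin-strict
      j * (l * θ) + x₀ * θ   ≡⟨ scale x₀ j l θ ⟨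
      (x₀ + j * l) * θ       <⟨ bound ⟩
      z₀ * w                 ≤⟨ m≤m+n (z₀ * w) r ⟩
      z₀ * w + r             ≡⟨ k₀-eq ⟨
      k₀ * (l * θ) + x₀ * θ  ∎))
      where open ≤-Reasoning

    j<k₀⇒bound : ∀ {j} → j < k₀ → (x₀ + j * l) * θ < z₀ * w
    j<k₀⇒bound {j} j<k₀ = +-cancelʳ-< (l * θ) _ _ (begin-strict
      (x₀ + j * l) * θ + l * θ        ≡⟨ step x₀ j l θ ⟩
      suc j * (l * θ) + x₀ * θ        ≤⟨ +-monoˡ-≤ (x₀ * θ) (*-monoˡ-≤ (l * θ) j<k₀) ⟩
      k₀ * (l * θ) + x₀ * θ           ≡⟨ k₀-eq ⟩
      z₀ * w + r                      <⟨ +-monoʳ-< (z₀ * w) r<lθ ⟩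
      z₀ * w + l * θ                  ∎)
      where
      open ≤-Reasoning
      step : ∀ x₀ j l θ → (x₀ + j * l) * θ + l * θ ≡ suc j * (l * θ) + x₀ * θ
      step = solve-∀

    -- From k θ ≤ z₀. Together with `bound⇒j<k₀` it confines the excess to the columns j < `k₀`.
    kw-bound : ∀ {k j} → k ≤ A → x₀ + j * l < k * w → (x₀ + j * l) * θ < z₀ * w
    kw-bound {k} {j} k≤A x<kw = begin-strict
      (x₀ + j * l) * θ  <⟨ *-monoˡ-< θ x<kw ⟩
      k * w * θ         ≡⟨ swap k w θ ⟩
      k * θ * w         ≤⟨ *-monoˡ-≤ w (m≤o/n⇒m*n≤o k≤A) ⟩
      z₀ * w            ∎
      where
      open ≤-Reasoning
      swap : ∀ k w θ → k * w * θ ≡ k * θ * w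
      swap = solve-∀

    -- Makes each subtraction `A ∸ fx j` in the excess exact.
    fx≤A : ∀ j → j < k₀ → fx j ≤ A
    fx≤A j j<k₀ = m*n≤o⇒m≤o/n (*-cancelʳ-≤ (fx j * θ) z₀ w (begin
      fx j * θ * w      ≡⟨ swap (fx j) θ w ⟩
      fx j * w * θ      ≤⟨ *-monoˡ-≤ θ (m/n*n≤m (x₀ + j * l) w) ⟩
      (x₀ + j * l) * θ  ≤⟨ <⇒≤ (j<k₀⇒bound j<k₀) ⟩
      z₀ * w            ∎))
      where
      open ≤-Reasoning
      swap : ∀ f θ w → f * θ * w ≡ f * w * θ
      swap = solve-∀

    -- fx (1 + A) > A because w ≤ l, so 1 + A < k₀ would contradict fx≤A.
    k₀≤1+A : k₀ ≤ 1 + A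
    k₀≤1+A = ≮⇒≥ λ 1+A<k₀ → <⇒≱ (n<1+n A) (≤-trans
      (m*n≤o⇒m≤o/n (≤-trans (*-monoʳ-≤ (1 + A) w≤l) (m≤n+m ((1 + A) * l) x₀)))
      (fx≤A (1 + A) 1+A<k₀))

    -- Kept additive so that no truncated subtraction remains before passing to ℤ.
    denumerant-balance : D + k₀ * A ≡ ∑[ k < 1 + A ] (1 + fy k) + ∑< k₀ fx
    denumerant-balance = begin
      D + k₀ * A                                     ≡⟨ cong (λ t → D + t) (∑-∸ k₀ A fx fx≤A) ⟨
      D + (∑[ j < k₀ ] (A ∸ fx j) + ∑< k₀ fx)        ≡⟨ +-assoc D _ _ ⟨
      D + ∑[ j < k₀ ] (A ∸ fx j) + ∑< k₀ fx
        ≡⟨ cong (_+ ∑< k₀ fx) (denumerant+excess k₀ fx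
             -- For w > 0 the condition x₀ + j l < k w is equivalent to `fx j` < k.
             (λ k j k≤A x<kw → bound⇒j<k₀ {j} (kw-bound {k} {j} k≤A x<kw) , m<n*o⇒m/o<n x<kw)
             (λ k j fxj<k _ → <-≤-trans (m<[1+m/n]*n (x₀ + j * l) w) (*-monoˡ-≤ w fxj<k))) ⟩
      ∑[ k < 1 + A ] (1 + fy k) + ∑< k₀ fx           ∎
      where open ≡-Reasoning

    denumerant-ℤ :
      + D ≡ + (1 + A) ℤ.+ (+ (1 + A) ℤ.* + ȳ₀ ℤ.+ + T ℤ.* + h̄ ℤ.+ + Sy)
            ℤ.+ (+ k₀ ℤ.* + x̄₀ ℤ.+ + ((k₀ ∸ 1) * k₀ / 2) ℤ.* + l̄ ℤ.+ + Sx k₀)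
            ℤ.- + k₀ ℤ.* + A
    denumerant-ℤ = begin
      + D
        ≡⟨ cancel (+ D) (+ (k₀ * A)) ⟩
      + (D + k₀ * A) ℤ.- + (k₀ * A)
        ≡⟨ cong₂ (λ s t → + s ℤ.- t) denumerant-balance (ℤ.pos-* k₀ A) ⟩
      + (∑[ k < 1 + A ] (1 + fy k)) ℤ.+ + ∑< k₀ fx ℤ.- + k₀ ℤ.* + A
        ≡⟨ cong₂ (λ s t → s ℤ.+ t ℤ.- + k₀ ℤ.* + A) ∑-1+fy-ℤ
             (trans (cong +_ (∑-[p+kq]/d k₀ x₀ l w))
               (cong₂ (λ s t → s ℤ.+ t ℤ.+ + Sx k₀) (ℤ.pos-* k₀ x̄₀) (ℤ.pos-* T₀ l̄))) ⟩
      + (1 + A) ℤ.+ (+ (1 + A) ℤ.* + ȳ₀ ℤ.+ + T ℤ.* + h̄ ℤ.+ + Sy)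
        ℤ.+ (+ k₀ ℤ.* + x̄₀ ℤ.+ + T₀ ℤ.* + l̄ ℤ.+ + Sx k₀) ℤ.- + k₀ ℤ.* + A ∎
      where
      open ≡-Reasoning
      T₀ = (k₀ ∸ 1) * k₀ / 2
      cancel : ∀ s t → s ≡ s ℤ.+ t ℤ.- t
      cancel = ℤ-RingSolver.solve-∀

    k₀≤A-formula :
      + D ≡ + ((1 + A) * (1 + A + ȳ₀))
            ℤ.+ + k₀ ℤ.* (+ x̄₀ ℤ.- + A)
            ℤ.+ (+ h̄ ℤ.- + 2) ℤ.* + T
            ℤ.+ + l̄ ℤ.* + ((k₀ ∸ 1) * k₀ / 2)
            ℤ.+ + Sy
            ℤ.+ + Sx k₀
    k₀≤A-formula = trans denumerant-ℤ (trans (sym (triangular-cancel A _))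
      (trans (regroup (+ A) (+ ȳ₀) (+ T) (+ h̄) (+ Sy) (+ k₀) (+ x̄₀) (+ T₀) (+ l̄) (+ Sx k₀))
        (cong (λ t → t ℤ.+ + k₀ ℤ.* (+ x̄₀ ℤ.- + A) ℤ.+ (+ h̄ ℤ.- + 2) ℤ.* + T
                     ℤ.+ + l̄ ℤ.* + T₀ ℤ.+ + Sy ℤ.+ + Sx k₀)
              (sym (ℤ.pos-* (1 + A) (1 + A + ȳ₀))))))
      where
      T₀ = (k₀ ∸ 1) * k₀ / 2
      regroup : ∀ A ȳ₀ T h̄ Sy k₀ x̄₀ T₀ l̄ Sx →
        + 1 ℤ.+ A ℤ.+ ((+ 1 ℤ.+ A) ℤ.* ȳ₀ ℤ.+ T ℤ.* h̄ ℤ.+ Sy)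
          ℤ.+ (k₀ ℤ.* x̄₀ ℤ.+ T₀ ℤ.* l̄ ℤ.+ Sx) ℤ.- k₀ ℤ.* A
          ℤ.+ (A ℤ.* (+ 1 ℤ.+ A) ℤ.- T ℤ.* + 2) ≡
        (+ 1 ℤ.+ A) ℤ.* (+ 1 ℤ.+ A ℤ.+ ȳ₀) ℤ.+ k₀ ℤ.* (x̄₀ ℤ.- A) ℤ.+ (h̄ ℤ.- + 2) ℤ.* T
          ℤ.+ l̄ ℤ.* T₀ ℤ.+ Sy ℤ.+ Sx
      regroup = ℤ-RingSolver.solve-∀

    -- With `k₀` = 1 + A both triangular numbers coincide, and -`k₀` A cancels the term A (1 + A)
    -- brought in by `triangular-cancel`.
    A<k₀-formula : A < k₀ →
      + D ≡ + ((1 + A) * (1 + x̄₀ + ȳ₀))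
            ℤ.+ (+ l̄ ℤ.+ + h̄ ℤ.- + 2) ℤ.* + T
            ℤ.+ + Sx (1 + A)
            ℤ.+ + Sy
    A<k₀-formula A<k₀ = trans denumerant-ℤ
      (trans (cong (λ k → + (1 + A) ℤ.+ (+ (1 + A) ℤ.* + ȳ₀ ℤ.+ + T ℤ.* + h̄ ℤ.+ + Sy)
            ℤ.+ (+ k ℤ.* + x̄₀ ℤ.+ + ((k ∸ 1) * k / 2) ℤ.* + l̄ ℤ.+ + Sx k)
            ℤ.- + k ℤ.* + A) (≤-antisym k₀≤1+A A<k₀))
      (trans (sym (triangular-cancel A _))
      (trans (regroup (+ A) (+ ȳ₀) (+ T) (+ h̄) (+ Sy) (+ x̄₀) (+ l̄) (+ Sx (1 + A)))
        (cong (λ t → t ℤ.+ (+ l̄ ℤ.+ + h̄ ℤ.- + 2) ℤ.* + T ℤ.+ + Sx (1 + A) ℤ.+ + Sy)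
              (sym (ℤ.pos-* (1 + A) (1 + x̄₀ + ȳ₀)))))))
      where
      regroup : ∀ A ȳ₀ T h̄ Sy x̄₀ l̄ Sx →
        + 1 ℤ.+ A ℤ.+ ((+ 1 ℤ.+ A) ℤ.* ȳ₀ ℤ.+ T ℤ.* h̄ ℤ.+ Sy)
          ℤ.+ ((+ 1 ℤ.+ A) ℤ.* x̄₀ ℤ.+ T ℤ.* l̄ ℤ.+ Sx) ℤ.- (+ 1 ℤ.+ A) ℤ.* A
          ℤ.+ (A ℤ.* (+ 1 ℤ.+ A) ℤ.- T ℤ.* + 2) ≡
        (+ 1 ℤ.+ A) ℤ.* (+ 1 ℤ.+ x̄₀ ℤ.+ ȳ₀) ℤ.+ (l̄ ℤ.+ h̄ ℤ.- + 2) ℤ.* T ℤ.+ Sx ℤ.+ Sy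
      regroup = ℤ-RingSolver.solve-∀

-- Factoring a and b when δ = 0.

-- With δ = 0 the two relations read l a = y b and θ c + w a = h b.
module Degenerate
  {a b c l h w y θ : ℕ} .{{_ : NonZero a}} .{{_ : NonZero b}} .{{_ : NonZero c}} .{{_ : NonZero l}}
  (la≡yb : l * a ≡ y * b) (θc+wa≡hb : θ * c + w * a ≡ h * b) (c+wy≡lh : c + w * y ≡ l * h)
  where

  -- Multiply the second relation by l and replace l a by y b; then w y b cancels against l h = c +
  -- w y, and c cancels last.
  b≡lθ : b ≡ l * θ
  b≡lθ = *-cancelʳ-≡ b (l * θ) c (+-cancelʳ-≡ (w * y * b) _ _ (begin
    b * c + w * y * b          ≡⟨ factor b c (w * y) ⟩
    (c + w * y) * b            ≡⟨ cong (_* b) c+wy≡lh ⟩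
    l * h * b                  ≡⟨ *-assoc l h b ⟩
    l * (h * b)                ≡⟨ cong (l *_) θc+wa≡hb ⟨
    l * (θ * c + w * a)        ≡⟨ expand l θ c w a ⟩
    l * θ * c + w * (l * a)    ≡⟨ cong (λ t → l * θ * c + w * t) la≡yb ⟩
    l * θ * c + w * (y * b)    ≡⟨ cong (λ t → l * θ * c + t) (*-assoc w y b) ⟨
    l * θ * c + w * y * b      ∎))
    where
    open ≡-Reasoning
    factor : ∀ b c t → b * c + t * b ≡ (c + t) * b
    factor = solve-∀
    expand : ∀ l θ c w a → l * (θ * c + w * a) ≡ l * θ * c + w * (l * a)
    expand = solve-∀

  a≡yθ : a ≡ y * θ
  a≡yθ = *-cancelˡ-≡ a (y * θ) l (begin
    l * a        ≡⟨ la≡yb ⟩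
    y * b        ≡⟨ cong (y *_) b≡lθ ⟩
    y * (l * θ)  ≡⟨ swap y l θ ⟩
    l * (y * θ)  ∎)
    where
    open ≡-Reasoning
    swap : ∀ y l θ → y * (l * θ) ≡ l * (y * θ)
    swap = solve-∀

  0<y : 0 < y
  0<y = >-nonZero⁻¹ y {{m*n≢0⇒m≢0 y {{subst NonZero a≡yθ it}}}}

  0<θ : 0 < θ
  0<θ = >-nonZero⁻¹ θ {{m*n≢0⇒n≢0 l {{subst NonZero b≡lθ it}}}}

-- From the L-shape to the lattice hypotheses, and the cases on w and the ceiling.

-- Every quotient by 2 below is exact (a product of consecutive naturals).
theorem5 :
  (a b c : ℕ) .{{_ : NonZero a}} .{{_ : NonZero b}} .{{_ : NonZero c}} →
  a < b → b < c → gcd a (gcd b c) ≡ 1 →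
  (H : LShape) → Related a b c H →
  let open LShape H in
  (δ θ : ℕ) →
  + δ ℤ.* + c ≡ + (l * a) ℤ.- + (y * b) →
  + θ ℤ.* + c ≡ + (h * b) ℤ.- + (w * a) →
  (m : ℕ) → m ∈⟨ a , b , c ⟩ →
  (x₀ y₀ z₀ : ℕ) → IsBasicFactorization a b c H m (x₀ , y₀ , z₀) →
  δ ≡ 0 →
  0 < y × 0 < θ ×
  (.{{_ : NonZero y}} .{{_ : NonZero θ}} →
    let
      d = + denumerant a b c m
      A = z₀ / θ
      ȳ₀ = y₀ / y
      ŷ₀ = y₀ % y
      h̄ = h / y
      ĥ = h % y
      star = + ((1 + A) * (1 + A + ȳ₀))
             ℤ.+ (+ h̄ ℤ.- + 2) ℤ.* + (A * (1 + A) / 2)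
             ℤ.+ + (∑[ k < 1 + A ] ((ŷ₀ + k * ĥ) / y))
    in
    (w ≡ 0 → d ≡ star)
    ×
    (.{{_ : NonZero w}} →
      let
        x̄₀ = x₀ / w
        x̂₀ = x₀ % w
        l̄ = l / w
        l̂ = l % w
      in
      Σ[ k₀ ∈ ℕ ]
        + k₀ ≡ ℚᵘ.ceiling ((+ (z₀ * w) ℤ.- + (x₀ * θ)) ℚᵘ./ b)
        × (k₀ ≡ 0 → d ≡ star)
        × (1 ≤ k₀ → k₀ ≤ A →
            d ≡ + ((1 + A) * (1 + A + ȳ₀))
                ℤ.+ + k₀ ℤ.* (+ x̄₀ ℤ.- + A)
                ℤ.+ (+ h̄ ℤ.- + 2) ℤ.* + (A * (1 + A) / 2)
                ℤ.+ + l̄ ℤ.* + ((k₀ ∸ 1) * k₀ / 2)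
                ℤ.+ + (∑[ k < 1 + A ] ((ŷ₀ + k * ĥ) / y))
                ℤ.+ + (∑[ k < k₀ ] ((x̂₀ + k * l̂) / w)))
        × (A < k₀ →
            d ≡ + ((1 + A) * (1 + x̄₀ + ȳ₀))
                ℤ.+ (+ l̄ ℤ.+ + h̄ ℤ.- + 2) ℤ.* + (A * (1 + A) / 2)
                ℤ.+ + (∑[ k < 1 + A ] ((x̂₀ + k * l̂) / w))
                ℤ.+ + (∑[ k < 1 + A ] ((ŷ₀ + k * ĥ) / y)))))
theorem5 a b c _ _ gcd≡1 H related δ θ δ-eq θ-eq m _ x₀ y₀ z₀ (m₀ , square) refl =
  0<y , 0<θ ,
  ( (λ w≡0 → trans d≡D (Lattice.no-excess-formula
      (λ k j _ → ≤-trans (≤-reflexive (trans (cong (k *_) w≡0) (*-zeroʳ k))) z≤n)))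
  -- The ceiling is nonnegative because x₀ < l gives x₀ θ < l θ = b.
  , (let k₀ , k₀≡ , r , r<b , eq = ceiling-ℕ (z₀ * w) (x₀ * θ) b x₀θ<b
         r<lθ  = subst (r <_) b≡lθ r<b
         k₀-eq = subst (λ t → k₀ * t + x₀ * θ ≡ z₀ * w + r) b≡lθ eq
         open Lattice.Positive {k₀} {r} r<lθ k₀-eq
     in  k₀ , k₀≡
       -- A pair with x₀ + j l < k w would force j < 0.
       , (λ k₀≡0 → trans d≡D (Lattice.no-excess-formula λ k j k≤A → ≮⇒≥ λ x<kw →
           n≮0 (subst (j <_) k₀≡0 (bound⇒j<k₀ {j} (kw-bound {k} {j} k≤A x<kw)))))
       , (λ _ _ → trans d≡D k₀≤A-formula)
       , (λ A<k₀ → trans d≡D (A<k₀-formula A<k₀))))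
  where
  open LShape H
  open Related related

  instance
    l≢0 : NonZero l
    l≢0 = >-nonZero (≤-<-trans z≤n w<l)

  c+wy≡lh : c + w * y ≡ l * h
  c+wy≡lh = trans (cong (_+ w * y) (sym area≡c)) (m∸n+n≡m (*-mono-≤ (<⇒≤ w<l) (<⇒≤ y<h)))

  open Degenerate {a} {b} {c} {l} {h} {w} {y} {θ}
    (sym (minuend-≡ 0 (l * a) (y * b) δ-eq))
    (minuend-≡ (θ * c) (h * b) (w * a) (trans (ℤ.pos-* θ c) θ-eq))
    c+wy≡lh

  common-divisor : ∀ {d} → d ∣ a → d ∣ b → d ∣ c → d ≡ 1
  common-divisor d∣a d∣b d∣c =
    ∣1⇒≡1 (subst (_ ∣_) gcd≡1 (gcd-greatest d∣a (gcd-greatest d∣b d∣c)))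

  -- A common divisor of l and y divides a = y θ, b = l θ and c = l h - w y.
  l⊥y : Coprime l y
  l⊥y {d} (d∣l , d∣y) = common-divisor
    (subst (d ∣_) (sym a≡yθ) (∣m⇒∣m*n θ d∣y))
    (subst (d ∣_) (sym b≡lθ) (∣m⇒∣m*n θ d∣l))
    (∣m+n∣m⇒∣n (subst (d ∣_) (trans (sym c+wy≡lh) (+-comm c (w * y))) (∣m⇒∣m*n h d∣l))
               (∣n⇒∣m*n w d∣y))

  θ⊥c : Coprime θ c
  θ⊥c {d} (d∣θ , d∣c) = common-divisor
    (subst (d ∣_) (sym a≡yθ) (∣n⇒∣m*n y d∣θ))
    (subst (d ∣_) (sym b≡lθ) (∣n⇒∣m*n l d∣θ))
    d∣c

  -- Modulo c both x a + Y b and x₀ a + y₀ b are m, so the minimal one leaves the larger multiple of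
  -- c.
  z≤z₀ : ∀ x Y z → IsFactorization a b c m (x , Y , z) → z ≤ z₀
  z≤z₀ x Y z mp = *-cancelʳ-≤ z z₀ c (+-cancelˡ-≤ (x₀ * a + y₀ * b) _ _ (begin
    x₀ * a + y₀ * b + z * c
      ≤⟨ +-monoˡ-≤ (z * c) (minimal x₀ y₀ square x Y congruent) ⟩
    x * a + Y * b + z * c
      ≡⟨ trans mp (sym m₀) ⟩
    x₀ * a + y₀ * b + z₀ * c ∎))
    where
    open ≤-Reasoning
    congruent : (x * a + Y * b) % c ≡ (x₀ * a + y₀ * b) % c
    congruent = trans (sym ([m+kn]%n≡m%n (x * a + Y * b) z c))
      (trans (%-congˡ (trans mp (sym m₀))) ([m+kn]%n≡m%n (x₀ * a + y₀ * b) z₀ c))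

  x₀<l : x₀ < l
  x₀<l = proj₁ square

  x₀θ<b : x₀ * θ < b
  x₀θ<b = subst (x₀ * θ <_) (sym b≡lθ) (*-monoˡ-< θ {{>-nonZero 0<θ}} x₀<l)

  d≡D : + denumerant a b c m ≡ + denumerant (y * θ) (l * θ) c m
  d≡D = cong₂ (λ a b → + denumerant a b c m) a≡yθ b≡lθ

  module Lattice .{{_ : NonZero y}} .{{_ : NonZero θ}} =
    FactorizationLattice {y₀ = y₀} (<⇒≤ w<l) (<⇒≤ y<h) c+wy≡lh l⊥y θ⊥c
      (subst₂ (λ a b → IsFactorization a b c m (x₀ , y₀ , z₀)) a≡yθ b≡lθ m₀) x₀<l
      (λ x Y z mp → z≤z₀ x Y z
        (subst₂ (λ a b → IsFactorization a b c m (x , Y , z)) (sym a≡yθ) (sym b≡lθ) mp))
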